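{- The Prime $k$-tuples Conjecture implies that there are infinitely many Lucas-Carmichael integers of degree $4$ with exactly five prime factors.
   Context: A Lucas-Carmichael integer is a square-free positive composite integer $n$ such that $p+1 \mid n+1$ for every prime $p$ dividing $n$. For an integer $b\ge 2$ and a positive integer $N$, $S_b(N)$ denotes the sum of the base-$b$ digits of $N$. The degree of a Lucas-Carmichael integer $n$ is the integer $\alpha = \max_{p\mid n} \frac{S_{p+2}(n+2)-1}{p+1}$, the maximum being over the prime divisors $p$ of $n$. Prime $k$-tuples Conjecture: Let $a_1,\ldots,a_k$ be positive integers, and let $b_1,\ldots,b_k$ be nonzero integers. For $m\ge 1$, define $f(m)=\prod_{i=1}^k (a_i m+b_i)$. Let $P(x)$ denote the number of positive integers $m\le x$ for which $a_i m+b_i$ is prime for each $i=1,\ldots,k$. The conjecture states that if no prime divides $f(m)$ for every $m$, then there exists $c>0$ such that $P(x)\sim \frac{cx}{\log^k x}$ as $x\to\infty$. -}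

module Defs where

open import Data.Digit using (toDigits)
open import Data.Empty using (⊥)
open import Data.Fin.Base using (Fin; toℕ)
open import Data.Fin.Properties using (all?)
open import Data.Integer.Base as ℤ using (ℤ; +_; -[1+_]; 0ℤ; 1ℤ)
import Data.Integer.Divisibility as ℤ
import Data.Integer.Properties as ℤₚ
open import Data.List.Base using (List; map; filter; length; upTo)
open import Data.List.Extrema.Nat using (max)
open import Data.Nat.Base as ℕ using (ℕ; zero; suc; NonZero; NonTrivial)
import Data.Nat.DivMod as ℕ
open import Data.Nat.Divisibility using (_∣_; _∣?_)
open import Data.Nat.ListAction using (sum)
open import Data.Nat.Primality using (Prime; prime?; Composite)
import Data.Nat.Properties as ℕₚ
open import Data.Product.Base using (∃; _×_; _,_; proj₁; proj₂)
open import Data.Rational.Base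
  using (ℚ; mkℚ; 0ℚ; 1ℚ; ½; _+_; _*_; _-_; -_; _≤_; _<_; ∣_∣; _⊔_; 1/_; _/_; toℚᵘ;
         Positive; NonNegative; positive; nonNegative)
open import Data.Rational.Properties
  hiding (_≟_; _≤?_)
open import Data.Rational.Solver using (module +-*-Solver)
import Data.Rational.Unnormalised.Base as ℚᵘ
import Data.Rational.Unnormalised.Properties as ℚᵘₚ
open import Data.Sum.Base using (inj₁; inj₂)
open import Data.Vec.Functional using (foldr)
open import Relation.Binary.PropositionalEquality
open import Relation.Nullary using (¬_; Dec; no)
open import Relation.Nullary.Decidable using (True; _×-dec_)

open +-*-Solver using (solve; _:+_; _:*_; _:-_; :-_; _:=_; con)

------------------------------------------------------------------------
-- Lucas-Carmichael integers and their degree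

SquareFree : ℕ → Set
SquareFree n = ∀ d → d ℕ.* d ∣ n → d ≡ 1

record LucasCarmichael (n : ℕ) : Set where
  field
    composite  : Composite n
    squareFree : SquareFree n
    1+p∣1+n    : ∀ p → Prime p → p ∣ n → suc p ∣ suc n

primeDivisors : ℕ → List ℕ
primeDivisors n = filter (λ p → prime? p ×-dec (p ∣? n)) (upTo (suc n))

digitSum : (b : ℕ) {b≥2 : True (2 ℕₚ.≤? b)} → ℕ → ℕ
digitSum b {b≥2} N = sum (map toℕ (proj₁ (toDigits b {b≥2} N)))

-- For a Lucas-Carmichael integer n the division is exact: modulo p + 1, the
-- digit sum of n + 2 in base p + 2 is congruent to n + 2, hence to 1.  The
-- list is then nonempty, so the default value 0 of the maximum is harmless.

degree : ℕ → ℕ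
degree n = max 0 (map (λ p → (digitSum (2 ℕ.+ p) (2 ℕ.+ n) ℕ.∸ 1) ℕ./ suc p)
                      (primeDivisors n))

------------------------------------------------------------------------
-- Rational arithmetic

∣-∣-intro : ∀ {p q e} → p ≤ q + e → q ≤ p + e → ∣ p - q ∣ ≤ e
∣-∣-intro {p} {q} {e} h₁ h₂ with ∣p∣≡p∨∣p∣≡-p (p - q)
... | inj₁ eq = subst (_≤ e) (sym eq)
  (≤-trans (+-monoˡ-≤ (- q) h₁) (≤-reflexive (lem q e)))
  where
  lem : ∀ q e → (q + e) - q ≡ e
  lem = solve 2 (λ q e → (q :+ e) :- q := e) refl
... | inj₂ eq = subst (_≤ e) (sym (trans eq (neg p q)))
  (≤-trans (+-monoˡ-≤ (- p) h₂) (≤-reflexive (lem p e)))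
  where
  lem : ∀ q e → (q + e) - q ≡ e
  lem = solve 2 (λ q e → (q :+ e) :- q := e) refl
  neg : ∀ p q → - (p - q) ≡ q - p
  neg = solve 2 (λ p q → :- (p :- q) := q :- p) refl

p≤∣p∣ : ∀ p → p ≤ ∣ p ∣
p≤∣p∣ p with ≤-total 0ℚ p
... | inj₁ 0≤p = ≤-reflexive (sym (0≤p⇒∣p∣≡p 0≤p))
... | inj₂ p≤0 = ≤-trans p≤0 (0≤∣p∣ p)

∣-∣-elim : ∀ {p q e} → ∣ p - q ∣ ≤ e → p ≤ q + e
∣-∣-elim {p} {q} {e} h = ≤-trans (≤-reflexive (lem p q))
  (+-monoʳ-≤ q (≤-trans (p≤∣p∣ (p - q)) h))
  where
  lem : ∀ p q → p ≡ q + (p - q)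
  lem = solve 2 (λ p q → p := q :+ (p :- q)) refl

∣-∣-sym : ∀ p q → ∣ p - q ∣ ≡ ∣ q - p ∣
∣-∣-sym p q = trans (sym (∣-p∣≡∣p∣ (p - q))) (cong ∣_∣ (lem p q))
  where
  lem : ∀ p q → - (p - q) ≡ q - p
  lem = solve 2 (λ p q → :- (p :- q) := q :- p) refl

*-mono-≤-nonNeg : ∀ {p q r s} → 0ℚ ≤ p → 0ℚ ≤ s → p ≤ q → r ≤ s → p * r ≤ q * s
*-mono-≤-nonNeg {p} {q} {r} {s} 0≤p 0≤s p≤q r≤s = ≤-trans
  (*-monoˡ-≤-nonNeg p {{nonNegative 0≤p}} r≤s)
  (*-monoʳ-≤-nonNeg s {{nonNegative 0≤s}} p≤q)

*-pos : ∀ {p q} → 0ℚ < p → 0ℚ < q → 0ℚ < p * q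
*-pos {p} {q} 0<p 0<q = positive⁻¹ _
  {{pos*pos⇒pos p {{positive 0<p}} q {{positive 0<q}}}}

fromℕℚ : ℕ → ℚ
fromℕℚ n = + n / 1

1/suc : ℕ → ℚ
1/suc n = + 1 / suc n

toℚᵘ-1/suc : ∀ n → toℚᵘ (1/suc n) ℚᵘ.≃ ℚᵘ.mkℚᵘ (+ 1) n
toℚᵘ-1/suc n = toℚᵘ-fromℚᵘ (ℚᵘ.mkℚᵘ (+ 1) n)

toℚᵘ-fromℕℚ : ∀ n → toℚᵘ (fromℕℚ n) ℚᵘ.≃ ℚᵘ.mkℚᵘ (+ n) 0
toℚᵘ-fromℕℚ n = toℚᵘ-fromℚᵘ (ℚᵘ.mkℚᵘ (+ n) 0)

1/suc-antitone : ∀ {m n} → m ℕ.≤ n → 1/suc n ≤ 1/suc m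
1/suc-antitone {m} {n} m≤n = toℚᵘ-cancel-≤ (begin
  toℚᵘ (1/suc n)      ≃⟨ toℚᵘ-1/suc n ⟩
  ℚᵘ.mkℚᵘ (+ 1) n     ≤⟨ ℚᵘ.*≤* (ℤₚ.*-monoˡ-≤-nonNeg (+ 1) (ℤ.+≤+ (ℕ.s≤s m≤n))) ⟩
  ℚᵘ.mkℚᵘ (+ 1) m     ≃⟨ toℚᵘ-1/suc m ⟨
  toℚᵘ (1/suc m)      ∎)
  where open ℚᵘₚ.≤-Reasoning

0<1/suc : ∀ n → 0ℚ < 1/suc n
0<1/suc n = positive⁻¹ (1/suc n) {{pos}}
  where pos = normalize-pos 1 (suc n)

fromℕℚ-suc : ∀ n → fromℕℚ (suc n) ≡ fromℕℚ n + 1ℚ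
fromℕℚ-suc n = toℚᵘ-injective (begin-equality
  toℚᵘ (fromℕℚ (suc n))                    ≃⟨ toℚᵘ-fromℕℚ (suc n) ⟩
  ℚᵘ.mkℚᵘ (+ suc n) 0                      ≃⟨ ℚᵘ.*≡* (cong (ℤ._* + 1) lem) ⟩
  ℚᵘ.mkℚᵘ (+ n) 0 ℚᵘ.+ ℚᵘ.1ℚᵘ              ≃⟨ ℚᵘₚ.+-congˡ ℚᵘ.1ℚᵘ (toℚᵘ-fromℕℚ n) ⟨
  toℚᵘ (fromℕℚ n) ℚᵘ.+ ℚᵘ.1ℚᵘ              ≃⟨ toℚᵘ-homo-+ (fromℕℚ n) 1ℚ ⟨
  toℚᵘ (fromℕℚ n + 1ℚ)                     ∎)
  where
  open ℚᵘₚ.≤-Reasoning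
  lem : + suc n ≡ + n ℤ.* + 1 ℤ.+ + 1 ℤ.* + 1
  lem = trans (cong +_ (ℕₚ.+-comm 1 n)) (cong (ℤ._+ + 1) (sym (ℤₚ.*-identityʳ (+ n))))

fromℕℚ-1/suc : ∀ b m →
  fromℕℚ (suc m) * 1/suc (m ℕ.+ b ℕ.* suc m) ≡ 1/suc b
fromℕℚ-1/suc b m = toℚᵘ-injective (begin-equality
  toℚᵘ (fromℕℚ (suc m) * 1/suc d)                ≃⟨ toℚᵘ-homo-* (fromℕℚ (suc m)) (1/suc d) ⟩
  toℚᵘ (fromℕℚ (suc m)) ℚᵘ.* toℚᵘ (1/suc d)      ≃⟨ ℚᵘₚ.*-cong (toℚᵘ-fromℕℚ (suc m)) (toℚᵘ-1/suc d) ⟩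
  ℚᵘ.mkℚᵘ (+ suc m) 0 ℚᵘ.* ℚᵘ.mkℚᵘ (+ 1) d       ≃⟨ ℚᵘ.*≡* (cong +_ lem) ⟩
  ℚᵘ.mkℚᵘ (+ 1) b                                ≃⟨ toℚᵘ-1/suc b ⟨
  toℚᵘ (1/suc b)                                 ∎)
  where
  open ℚᵘₚ.≤-Reasoning
  d = m ℕ.+ b ℕ.* suc m
  lem : suc m ℕ.* 1 ℕ.* suc b ≡ 1 ℕ.* (1 ℕ.* suc d)
  lem = trans (cong (ℕ._* suc b) (ℕₚ.*-identityʳ (suc m)))
       (trans (ℕₚ.*-comm (suc m) (suc b))
              (sym (trans (ℕₚ.*-identityˡ _) (ℕₚ.*-identityˡ (suc d)))))

archimedean : ∀ ε → 0ℚ < ε → ∃ λ N → 1/suc N ≤ ε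
archimedean ε@(mkℚ -[1+ _ ] _ _) 0<ε with () ← positive 0<ε
archimedean ε@(mkℚ (+ zero) _ _) 0<ε with () ← positive 0<ε
archimedean ε@(mkℚ (+ suc p) d _) 0<ε = d , toℚᵘ-cancel-≤ (begin
  toℚᵘ (1/suc d)         ≃⟨ toℚᵘ-1/suc d ⟩
  ℚᵘ.mkℚᵘ (+ 1) d        ≤⟨ ℚᵘ.*≤* (ℤₚ.*-monoʳ-≤-nonNeg (+ suc d) (ℤ.+≤+ (ℕ.s≤s (ℕ.z≤n {p})))) ⟩
  ℚᵘ.mkℚᵘ (+ suc p) d    ∎)
  where open ℚᵘₚ.≤-Reasoning

------------------------------------------------------------------------
-- Real numbers, as Cauchy sequences of rationals

record ℝ : Set where
  field
    approx : ℕ → ℚ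
    cauchy : ∀ ε → 0ℚ < ε → ∃ λ N → ∀ m n → N ℕ.≤ m → N ℕ.≤ n →
             ∣ approx m - approx n ∣ ≤ ε

open ℝ public

infix  4 _≤ℝ_ _<ℝ_
infixl 6 _-ℝ_
infixl 7 _*ℝ_
infixr 8 _^ℝ_

_≤ℝ_ : ℝ → ℝ → Set
x ≤ℝ y = ∀ ε → 0ℚ < ε → ∃ λ N → ∀ n → N ℕ.≤ n → approx x n ≤ approx y n + ε

_<ℝ_ : ℝ → ℝ → Set
x <ℝ y = ∃ λ δ → 0ℚ < δ × ∃ λ N → ∀ n → N ℕ.≤ n → approx x n + δ ≤ approx y n

fromℚ : ℚ → ℝ
fromℚ q .approx _ = q
fromℚ q .cauchy ε 0<ε = 0 , λ _ _ _ _ →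
  subst (_≤ ε) (sym (cong ∣_∣ (+-inverseʳ q))) (<⇒≤ 0<ε)

fromℕ : ℕ → ℝ
fromℕ n = fromℚ (fromℕℚ n)

0ℝ 1ℝ : ℝ
0ℝ = fromℚ 0ℚ
1ℝ = fromℚ 1ℚ

_-ℝ_ : ℝ → ℝ → ℝ
(x -ℝ y) .approx n = approx x n - approx y n
(x -ℝ y) .cauchy ε 0<ε =
  let ε/2 = ½ * ε
      0<ε/2 = *-pos {½} {ε} (positive⁻¹ ½) 0<ε
      N₁ , h₁ = cauchy x ε/2 0<ε/2
      N₂ , h₂ = cauchy y ε/2 0<ε/2
  in N₁ ℕ.⊔ N₂ , λ m n Nm Nn → begin
    ∣ (approx x m - approx y m) - (approx x n - approx y n) ∣
      ≡⟨ cong ∣_∣ (lem (approx x m) (approx y m) (approx x n) (approx y n)) ⟩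
    ∣ (approx x m - approx x n) - (approx y m - approx y n) ∣
      ≤⟨ ∣p-q∣≤∣p∣+∣q∣ (approx x m - approx x n) (approx y m - approx y n) ⟩
    ∣ approx x m - approx x n ∣ + ∣ approx y m - approx y n ∣
      ≤⟨ +-mono-≤ (h₁ m n (ℕₚ.m⊔n≤o⇒m≤o N₁ N₂ Nm) (ℕₚ.m⊔n≤o⇒m≤o N₁ N₂ Nn))
                  (h₂ m n (ℕₚ.m⊔n≤o⇒n≤o N₁ N₂ Nm) (ℕₚ.m⊔n≤o⇒n≤o N₁ N₂ Nn)) ⟩
    ε/2 + ε/2
      ≡⟨ halves ε ⟩
    ε ∎
  where
  open ≤-Reasoning
  lem : ∀ a b c d → (a - b) - (c - d) ≡ (a - c) - (b - d)
  lem = solve 4 (λ a b c d → (a :- b) :- (c :- d) := (a :- c) :- (b :- d)) refl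
  halves : ∀ e → ½ * e + ½ * e ≡ e
  halves = solve 1 (λ e → con ½ :* e :+ con ½ :* e := e) refl

∣_∣ℝ : ℝ → ℝ
∣ x ∣ℝ .approx n = ∣ approx x n ∣
∣ x ∣ℝ .cauchy ε 0<ε = let N , h = cauchy x ε 0<ε in
  N , λ m n Nm Nn → ∣-∣-intro {∣ approx x m ∣} {∣ approx x n ∣} {ε}
    (tri (approx x m) (approx x n) (h m n Nm Nn))
    (tri (approx x n) (approx x m) (h n m Nn Nm))
  where
  lem : ∀ p q → p ≡ q + (p - q)
  lem = solve 2 (λ p q → p := q :+ (p :- q)) refl
  tri : ∀ p q → ∣ p - q ∣ ≤ ε → ∣ p ∣ ≤ ∣ q ∣ + ε
  tri p q h = ≤-trans (≤-reflexive (cong ∣_∣ (lem p q)))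
    (≤-trans (∣p+q∣≤∣p∣+∣q∣ q (p - q)) (+-monoʳ-≤ ∣ q ∣ h))

bounded : ∀ x → ∃ λ B → 0ℚ ≤ B × ∃ λ N → ∀ n → N ℕ.≤ n → ∣ approx x n ∣ ≤ B
bounded x = let N , h = cauchy ∣ x ∣ℝ 1ℚ (positive⁻¹ 1ℚ) in
  ∣ approx x N ∣ + 1ℚ ,
  +-mono-≤ (0≤∣p∣ (approx x N)) (<⇒≤ (positive⁻¹ 1ℚ)) ,
  N , λ n Nn → ∣-∣-elim (h n N Nn ℕₚ.≤-refl)

_*ℝ_ : ℝ → ℝ → ℝ
(x *ℝ y) .approx n = approx x n * approx y n
(x *ℝ y) .cauchy ε 0<ε = N , close
  where
  bx = bounded x
  by = bounded y
  B₁ = proj₁ bx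
  B₂ = proj₁ by
  B = B₁ + B₂ + 1ℚ
  0<B : 0ℚ < B
  0<B = +-mono-≤-< (+-mono-≤ (proj₁ (proj₂ bx)) (proj₁ (proj₂ by))) (positive⁻¹ 1ℚ)
  instance
    B-pos : Positive B
    B-pos = positive 0<B
    B-nonZero = pos⇒nonZero B
  η = ε * 1/ B
  0<η : 0ℚ < η
  0<η = *-pos 0<ε (positive⁻¹ (1/ B) {{1/pos⇒pos B}})
  cx = cauchy x η 0<η
  cy = cauchy y η 0<η
  N₁ = proj₁ (proj₂ (proj₂ bx))
  N₂ = proj₁ (proj₂ (proj₂ by))
  N = (N₁ ℕ.⊔ N₂) ℕ.⊔ (proj₁ cx ℕ.⊔ proj₁ cy)
  split : ∀ a b c d → a * b - c * d ≡ a * (b - d) + (a - c) * d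
  split = solve 4 (λ a b c d → a :* b :- c :* d := a :* (b :- d) :+ (a :- c) :* d) refl
  gather : ∀ a b e → a * e + e * b ≡ e * (a + b)
  gather = solve 3 (λ a b e → a :* e :+ e :* b := e :* (a :+ b)) refl
  open ≤-Reasoning
  close : ∀ m n → N ℕ.≤ m → N ℕ.≤ n →
          ∣ approx x m * approx y m - approx x n * approx y n ∣ ≤ ε
  close m n Nm Nn = begin
    ∣ a * b - c * d ∣
      ≡⟨ cong ∣_∣ (split a b c d) ⟩
    ∣ a * (b - d) + (a - c) * d ∣
      ≤⟨ ∣p+q∣≤∣p∣+∣q∣ (a * (b - d)) ((a - c) * d) ⟩
    ∣ a * (b - d) ∣ + ∣ (a - c) * d ∣
      ≡⟨ cong₂ _+_ (∣p*q∣≡∣p∣*∣q∣ a (b - d)) (∣p*q∣≡∣p∣*∣q∣ (a - c) d) ⟩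
    ∣ a ∣ * ∣ b - d ∣ + ∣ a - c ∣ * ∣ d ∣
      ≤⟨ +-mono-≤
           (*-mono-≤-nonNeg (0≤∣p∣ a) (<⇒≤ 0<η)
             (proj₂ (proj₂ (proj₂ bx)) m (≤₁ Nm)) (proj₂ cy m n (≤₄ Nm) (≤₄ Nn)))
           (*-mono-≤-nonNeg (0≤∣p∣ (a - c)) (proj₁ (proj₂ by))
             (proj₂ cx m n (≤₃ Nm) (≤₃ Nn)) (proj₂ (proj₂ (proj₂ by)) n (≤₂ Nn))) ⟩
    B₁ * η + η * B₂
      ≡⟨ gather B₁ B₂ η ⟩
    η * (B₁ + B₂)
      ≤⟨ *-monoˡ-≤-nonNeg η {{nonNegative (<⇒≤ 0<η)}}
           (≤-trans (≤-reflexive (sym (+-identityʳ (B₁ + B₂))))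
                    (+-monoʳ-≤ (B₁ + B₂) (<⇒≤ (positive⁻¹ 1ℚ)))) ⟩
    η * B
      ≡⟨ trans (*-assoc ε (1/ B) B) (trans (cong (ε *_) (*-inverseˡ B)) (*-identityʳ ε)) ⟩
    ε ∎
    where
    a = approx x m
    b = approx y m
    c = approx x n
    d = approx y n
    ≤₁ : ∀ {k} → N ℕ.≤ k → N₁ ℕ.≤ k
    ≤₁ h = ℕₚ.m⊔n≤o⇒m≤o N₁ N₂ (ℕₚ.m⊔n≤o⇒m≤o (N₁ ℕ.⊔ N₂) _ h)
    ≤₂ : ∀ {k} → N ℕ.≤ k → N₂ ℕ.≤ k
    ≤₂ h = ℕₚ.m⊔n≤o⇒n≤o N₁ N₂ (ℕₚ.m⊔n≤o⇒m≤o (N₁ ℕ.⊔ N₂) _ h)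
    ≤₃ : ∀ {k} → N ℕ.≤ k → proj₁ cx ℕ.≤ k
    ≤₃ h = ℕₚ.m⊔n≤o⇒m≤o (proj₁ cx) (proj₁ cy) (ℕₚ.m⊔n≤o⇒n≤o (N₁ ℕ.⊔ N₂) _ h)
    ≤₄ : ∀ {k} → N ℕ.≤ k → proj₁ cy ℕ.≤ k
    ≤₄ h = ℕₚ.m⊔n≤o⇒n≤o (proj₁ cx) (proj₁ cy) (ℕₚ.m⊔n≤o⇒n≤o (N₁ ℕ.⊔ N₂) _ h)

_^ℝ_ : ℝ → ℕ → ℝ
x ^ℝ zero  = 1ℝ
x ^ℝ suc k = x *ℝ (x ^ℝ k)

^ℝ-pos : ∀ {x} → 0ℝ <ℝ x → ∀ k → 0ℝ <ℝ x ^ℝ k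
^ℝ-pos         0<x zero    = 1ℚ , positive⁻¹ 1ℚ , 0 , λ _ _ → ≤-refl
^ℝ-pos {x} 0<x@(δ , 0<δ , N , h) (suc k) =
  let δ′ , 0<δ′ , N′ , h′ = ^ℝ-pos {x} 0<x k
  in δ * δ′ , *-pos 0<δ 0<δ′ , N ℕ.⊔ N′ , λ n Nn →
     let δ≤  = ≤-trans (≤-reflexive (sym (+-identityˡ δ))) (h n (ℕₚ.m⊔n≤o⇒m≤o N N′ Nn))
         δ′≤ = ≤-trans (≤-reflexive (sym (+-identityˡ δ′))) (h′ n (ℕₚ.m⊔n≤o⇒n≤o N N′ Nn))
     in ≤-trans (≤-reflexive (+-identityˡ (δ * δ′)))
        (*-mono-≤-nonNeg (<⇒≤ 0<δ) (≤-trans (<⇒≤ 0<δ′) δ′≤) δ≤ δ′≤)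

-- Eventually approx y n ≥ δ, so the maximum with δ only changes finitely many
-- terms; it makes every term invertible.

reciprocal : (y : ℝ) → 0ℝ <ℝ y → ℝ
reciprocal y (δ , 0<δ , N , h) = record { approx = λ n → inv n ; cauchy = inv-cauchy }
  where
  term : ℕ → ℚ
  term n = δ ⊔ approx y n
  term-pos : ∀ n → Positive (term n)
  term-pos n = positive (<-≤-trans 0<δ (p≤p⊔q δ (approx y n)))
  inv : ℕ → ℚ
  inv n = (1/ term n) {{pos⇒nonZero (term n) {{term-pos n}}}}
  0≤inv : ∀ n → 0ℚ ≤ inv n
  0≤inv n = <⇒≤ (positive⁻¹ (inv n) {{1/pos⇒pos (term n) {{term-pos n}}}})
  inv-inverse : ∀ n → term n * inv n ≡ 1ℚ
  inv-inverse n = *-inverseʳ (term n) {{pos⇒nonZero (term n) {{term-pos n}}}}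
  term≡ : ∀ n → N ℕ.≤ n → term n ≡ approx y n
  term≡ n Nn = p≤q⇒p⊔q≡q (≤-trans (≤-reflexive (sym (+-identityˡ δ))) (h n Nn))
  δ*inv≤1 : ∀ n → δ * inv n ≤ 1ℚ
  δ*inv≤1 n = ≤-trans
    (*-monoʳ-≤-nonNeg (inv n) {{nonNegative (0≤inv n)}} (p≤p⊔q δ (approx y n)))
    (≤-reflexive (inv-inverse n))
  diff : ∀ a b i j → a * i ≡ 1ℚ → b * j ≡ 1ℚ → i - j ≡ (b - a) * (i * j)
  diff a b i j ai bj = begin-equality
    i - j                       ≡⟨ cong₂ _-_ (*-identityʳ i) (*-identityʳ j) ⟨
    i * 1ℚ - j * 1ℚ             ≡⟨ cong₂ (λ u v → i * u - j * v) bj ai ⟨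
    i * (b * j) - j * (a * i)   ≡⟨ lem a b i j ⟩
    (b - a) * (i * j)           ∎
    where
    open ≤-Reasoning
    lem : ∀ a b i j → i * (b * j) - j * (a * i) ≡ (b - a) * (i * j)
    lem = solve 4 (λ a b i j → i :* (b :* j) :- j :* (a :* i) := (b :- a) :* (i :* j)) refl
  inv-cauchy : ∀ ε → 0ℚ < ε → ∃ λ M → ∀ m n → M ℕ.≤ m → M ℕ.≤ n → ∣ inv m - inv n ∣ ≤ ε
  inv-cauchy ε 0<ε = M , close
    where
    η = ε * (δ * δ)
    cy = cauchy y η (*-pos 0<ε (*-pos 0<δ 0<δ))
    M = N ℕ.⊔ proj₁ cy
    shuffle : ∀ e d i j → e * (d * d) * (i * j) ≡ e * ((d * i) * (d * j))
    shuffle = solve 4 (λ e d i j → e :* (d :* d) :* (i :* j) := e :* ((d :* i) :* (d :* j))) refl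
    open ≤-Reasoning
    close : ∀ m n → M ℕ.≤ m → M ℕ.≤ n → ∣ inv m - inv n ∣ ≤ ε
    close m n Mm Mn = begin
      ∣ inv m - inv n ∣
        ≡⟨ cong ∣_∣ (diff (term m) (term n) (inv m) (inv n) (inv-inverse m) (inv-inverse n)) ⟩
      ∣ (term n - term m) * (inv m * inv n) ∣
        ≡⟨ ∣p*q∣≡∣p∣*∣q∣ (term n - term m) (inv m * inv n) ⟩
      ∣ term n - term m ∣ * ∣ inv m * inv n ∣
        ≡⟨ cong₂ (λ u v → ∣ u ∣ * v)
             (cong₂ _-_ (term≡ n (ℕₚ.m⊔n≤o⇒m≤o N _ Mn)) (term≡ m (ℕₚ.m⊔n≤o⇒m≤o N _ Mm)))
             (0≤p⇒∣p∣≡p 0≤ij) ⟩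
      ∣ approx y n - approx y m ∣ * (inv m * inv n)
        ≤⟨ *-monoʳ-≤-nonNeg (inv m * inv n) {{nonNegative 0≤ij}}
             (proj₂ cy n m (ℕₚ.m⊔n≤o⇒n≤o N _ Mn) (ℕₚ.m⊔n≤o⇒n≤o N _ Mm)) ⟩
      η * (inv m * inv n)
        ≡⟨ shuffle ε δ (inv m) (inv n) ⟩
      ε * ((δ * inv m) * (δ * inv n))
        ≤⟨ *-monoˡ-≤-nonNeg ε {{nonNegative (<⇒≤ 0<ε)}}
             (*-mono-≤-nonNeg (0≤* (<⇒≤ 0<δ) (0≤inv m)) (<⇒≤ (positive⁻¹ 1ℚ))
               (δ*inv≤1 m) (δ*inv≤1 n)) ⟩
      ε * (1ℚ * 1ℚ)
        ≡⟨ *-identityʳ ε ⟩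
      ε ∎
      where
      0≤* : ∀ {p q} → 0ℚ ≤ p → 0ℚ ≤ q → 0ℚ ≤ p * q
      0≤* {p} {q} 0≤p 0≤q = ≤-trans (≤-reflexive (sym (*-zeroʳ p)))
        (*-monoˡ-≤-nonNeg p {{nonNegative 0≤p}} 0≤q)
      0≤ij : 0ℚ ≤ inv m * inv n
      0≤ij = 0≤* (0≤inv m) (0≤inv n)

------------------------------------------------------------------------
-- The natural logarithm

-- segment a l = 1/(a+1) + 1/(a+2) + ⋯ + 1/(a+l)

segment : ℕ → ℕ → ℚ
segment a zero    = 0ℚ
segment a (suc l) = segment a l + 1/suc (a ℕ.+ l)

segment-+ : ∀ a l l′ → segment a (l ℕ.+ l′) ≡ segment a l + segment (a ℕ.+ l) l′
segment-+ a l zero = trans (cong (segment a) (ℕₚ.+-identityʳ l)) (sym (+-identityʳ _))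
segment-+ a l (suc l′) = begin-equality
  segment a (l ℕ.+ suc l′)
    ≡⟨ cong (segment a) (ℕₚ.+-suc l l′) ⟩
  segment a (l ℕ.+ l′) + 1/suc (a ℕ.+ (l ℕ.+ l′))
    ≡⟨ cong₂ (λ u v → u + 1/suc v) (segment-+ a l l′) (sym (ℕₚ.+-assoc a l l′)) ⟩
  segment a l + segment (a ℕ.+ l) l′ + 1/suc (a ℕ.+ l ℕ.+ l′)
    ≡⟨ +-assoc (segment a l) _ _ ⟩
  segment a l + segment (a ℕ.+ l) (suc l′) ∎
  where open ≤-Reasoning

0≤segment : ∀ a l → 0ℚ ≤ segment a l
0≤segment a zero    = ≤-refl
0≤segment a (suc l) = +-mono-≤ (0≤segment a l) (<⇒≤ (0<1/suc (a ℕ.+ l)))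

segment-≥ : ∀ a d l → a ℕ.+ l ℕ.≤ suc d → fromℕℚ l * 1/suc d ≤ segment a l
segment-≥ a d zero    _ = ≤-reflexive (*-zeroˡ (1/suc d))
segment-≥ a d (suc l) h = begin
  fromℕℚ (suc l) * 1/suc d        ≡⟨ cong (_* 1/suc d) (fromℕℚ-suc l) ⟩
  (fromℕℚ l + 1ℚ) * 1/suc d       ≡⟨ *-distribʳ-+ (1/suc d) (fromℕℚ l) 1ℚ ⟩
  fromℕℚ l * 1/suc d + 1ℚ * 1/suc d
    ≤⟨ +-mono-≤ (segment-≥ a d l (ℕₚ.≤-trans (ℕₚ.+-monoʳ-≤ a (ℕₚ.n≤1+n l)) h))
       (≤-trans (≤-reflexive (*-identityˡ (1/suc d))) (1/suc-antitone a+l≤d)) ⟩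
  segment a l + 1/suc (a ℕ.+ l)   ∎
  where
  open ≤-Reasoning
  a+l≤d : a ℕ.+ l ℕ.≤ d
  a+l≤d = ℕₚ.≤-pred (subst (ℕ._≤ suc d) (ℕₚ.+-suc a l) h)

segment-≤ : ∀ a d l → d ℕ.≤ a → segment a l ≤ fromℕℚ l * 1/suc d
segment-≤ a d zero    _ = ≤-reflexive (sym (*-zeroˡ (1/suc d)))
segment-≤ a d (suc l) h = begin
  segment a l + 1/suc (a ℕ.+ l)
    ≤⟨ +-mono-≤ (segment-≤ a d l h)
       (≤-trans (1/suc-antitone (ℕₚ.≤-trans h (ℕₚ.m≤m+n a l)))
                (≤-reflexive (sym (*-identityˡ (1/suc d))))) ⟩
  fromℕℚ l * 1/suc d + 1ℚ * 1/suc d   ≡⟨ *-distribʳ-+ (1/suc d) (fromℕℚ l) 1ℚ ⟨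
  (fromℕℚ l + 1ℚ) * 1/suc d           ≡⟨ cong (_* 1/suc d) (fromℕℚ-suc l) ⟨
  fromℕℚ (suc l) * 1/suc d            ∎
  where open ≤-Reasoning

block-≥ : ∀ b m → 1/suc b ≤ segment (b ℕ.* suc m) (suc m)
block-≥ b m = ≤-trans (≤-reflexive (sym (fromℕℚ-1/suc b m)))
  (segment-≥ (b ℕ.* suc m) (m ℕ.+ b ℕ.* suc m) (suc m)
    (ℕₚ.≤-reflexive (ℕₚ.+-comm (b ℕ.* suc m) (suc m))))

block-≤ : ∀ b m → segment (suc b ℕ.* suc m) (suc m) ≤ 1/suc b
block-≤ b m = ≤-trans
  (segment-≤ (suc b ℕ.* suc m) (m ℕ.+ b ℕ.* suc m) (suc m) (ℕₚ.n≤1+n _))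
  (≤-reflexive (fromℕℚ-1/suc b m))

refine-snoc : ∀ a l m → segment (a ℕ.* suc m) (suc l ℕ.* suc m) ≡
  segment (a ℕ.* suc m) (l ℕ.* suc m) + segment ((a ℕ.+ l) ℕ.* suc m) (suc m)
refine-snoc a l m = trans
  (cong (segment (a ℕ.* suc m)) (ℕₚ.+-comm (suc m) (l ℕ.* suc m)))
  (trans (segment-+ (a ℕ.* suc m) (l ℕ.* suc m) (suc m))
    (cong (λ z → segment (a ℕ.* suc m) (l ℕ.* suc m) + segment z (suc m))
      (sym (ℕₚ.*-distribʳ-+ (suc m) a l))))

refine-≥ : ∀ a l m → segment a l ≤ segment (a ℕ.* suc m) (l ℕ.* suc m)
refine-≥ a zero    m = ≤-refl
refine-≥ a (suc l) m = ≤-trans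
  (+-mono-≤ (refine-≥ a l m) (block-≥ (a ℕ.+ l) m))
  (≤-reflexive (sym (refine-snoc a l m)))

refine-≤′ : ∀ a l m →
  segment (suc a ℕ.* suc m) (l ℕ.* suc m) + 1/suc (a ℕ.+ l) ≤ segment (suc a) l + 1/suc a
refine-≤′ a zero    m = ≤-reflexive (cong (λ z → 0ℚ + 1/suc z) (ℕₚ.+-identityʳ a))
refine-≤′ a (suc l) m = begin
  segment (suc a ℕ.* suc m) (suc l ℕ.* suc m) + 1/suc (a ℕ.+ suc l)
    ≡⟨ cong₂ (λ u v → u + 1/suc v) (refine-snoc (suc a) l m) (ℕₚ.+-suc a l) ⟩
  S + segment ((suc a ℕ.+ l) ℕ.* suc m) (suc m) + w
    ≤⟨ +-monoˡ-≤ w (+-monoʳ-≤ S (block-≤ (a ℕ.+ l) m)) ⟩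
  S + 1/suc (a ℕ.+ l) + w
    ≤⟨ +-monoˡ-≤ w (refine-≤′ a l m) ⟩
  segment (suc a) l + 1/suc a + w
    ≡⟨ swap (segment (suc a) l) (1/suc a) w ⟩
  segment (suc a) l + w + 1/suc a ∎
  where
  open ≤-Reasoning
  S = segment (suc a ℕ.* suc m) (l ℕ.* suc m)
  w = 1/suc (suc a ℕ.+ l)
  swap : ∀ p q r → p + q + r ≡ p + r + q
  swap = solve 3 (λ p q r → p :+ q :+ r := p :+ r :+ q) refl

refine-≤ : ∀ a l m →
  segment (suc a ℕ.* suc m) (l ℕ.* suc m) ≤ segment (suc a) l + 1/suc a
refine-≤ a l m = ≤-trans (≤-trans (≤-reflexive (sym (+-identityʳ S)))
  (+-monoʳ-≤ S (<⇒≤ (0<1/suc (a ℕ.+ l))))) (refine-≤′ a l m)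
  where S = segment (suc a ℕ.* suc m) (l ℕ.* suc m)

-- For x ≥ 1, log x is the integral of 1/t over [1 , x], the limit of the right
-- Riemann sums with M = 1 + n subintervals of length 1/M per unit:
--   ∑ (1/M) · 1/(1 + j/M) = ∑ 1/(M + j)   over   1 ≤ j ≤ (x - 1) M.
-- log 0 has the irrelevant value 0.

riemann : ℕ → ℕ → ℚ
riemann x n = segment (suc n) ((x ℕ.∸ 1) ℕ.* suc n)

riemann-close : ∀ x m n → riemann x m ≤ riemann x n + 1/suc n
riemann-close x m n = begin
  segment (suc m) (k ℕ.* suc m)
    ≤⟨ refine-≥ (suc m) (k ℕ.* suc m) n ⟩
  segment (suc m ℕ.* suc n) (k ℕ.* suc m ℕ.* suc n)
    ≡⟨ cong₂ segment (ℕₚ.*-comm (suc m) (suc n))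
         (trans (ℕₚ.*-assoc k (suc m) (suc n))
         (trans (cong (k ℕ.*_) (ℕₚ.*-comm (suc m) (suc n)))
                (sym (ℕₚ.*-assoc k (suc n) (suc m))))) ⟩
  segment (suc n ℕ.* suc m) (k ℕ.* suc n ℕ.* suc m)
    ≤⟨ refine-≤ n (k ℕ.* suc n) m ⟩
  segment (suc n) (k ℕ.* suc n) + 1/suc n ∎
  where
  open ≤-Reasoning
  k = x ℕ.∸ 1

log : ℕ → ℝ
log x .approx = riemann x
log x .cauchy ε 0<ε = let N , h = archimedean ε 0<ε in
  N , λ m n Nm Nn → ∣-∣-intro
    (≤-trans (riemann-close x m n) (+-monoʳ-≤ (riemann x n) (≤-trans (1/suc-antitone Nn) h)))
    (≤-trans (riemann-close x n m) (+-monoʳ-≤ (riemann x m) (≤-trans (1/suc-antitone Nm) h)))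

log-pos : ∀ x .{{_ : NonTrivial x}} → 0ℝ <ℝ log x
log-pos (suc (suc x)) = 1/suc 1 , 0<1/suc 1 , 0 , λ n _ → begin
  0ℚ + 1/suc 1
    ≡⟨ +-identityˡ (1/suc 1) ⟩
  1/suc 1
    ≤⟨ block-≥ 1 n ⟩
  segment (1 ℕ.* suc n) (suc n)
    ≡⟨ cong (λ z → segment z (suc n)) (ℕₚ.*-identityˡ (suc n)) ⟩
  segment (suc n) (suc n)
    ≡⟨ +-identityʳ _ ⟨
  segment (suc n) (suc n) + 0ℚ
    ≤⟨ +-monoʳ-≤ (segment (suc n) (suc n)) (0≤segment (suc n ℕ.+ suc n) (x ℕ.* suc n)) ⟩
  segment (suc n) (suc n) + segment (suc n ℕ.+ suc n) (x ℕ.* suc n)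
    ≡⟨ segment-+ (suc n) (suc n) (x ℕ.* suc n) ⟨
  segment (suc n) (suc n ℕ.+ x ℕ.* suc n) ∎
  where open ≤-Reasoning

------------------------------------------------------------------------
-- The prime k-tuples conjecture

-- The functions compared are only defined from 2 on, where log x > 0.

infix 4 _~_

_~_ : (f g : (x : ℕ) → .{{NonTrivial x}} → ℝ) → Set
f ~ g = ∀ ε → 0ℚ < ε → ∃ λ X → ∀ x .{{_ : NonTrivial x}} → X ℕ.≤ x →
        ∣ f x -ℝ g x ∣ℝ ≤ℝ fromℚ ε *ℝ ∣ g x ∣ℝ

IsPrime : ℤ → Set
IsPrime (+ n)    = Prime n
IsPrime -[1+ _ ] = ⊥

isPrime? : ∀ z → Dec (IsPrime z)
isPrime? (+ n)    = prime? n
isPrime? -[1+ _ ] = no λ ()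

linear : ∀ {k} → (Fin k → ℕ) → (Fin k → ℤ) → Fin k → ℕ → ℤ
linear a b i m = + a i ℤ.* + m ℤ.+ b i

productForm : ∀ {k} → (Fin k → ℕ) → (Fin k → ℤ) → ℕ → ℤ
productForm a b m = foldr ℤ._*_ 1ℤ (λ i → linear a b i m)

primeTupleCount : ∀ {k} → (Fin k → ℕ) → (Fin k → ℤ) → ℕ → ℕ
primeTupleCount a b x =
  length (filter (λ m → all? (λ i → isPrime? (linear a b i m))) (map suc (upTo x)))

-- The linear forms are required to be pairwise distinct, as is always meant:
-- with repetitions allowed, the cases m + 1 (k = 1) and m + 1 , m + 1 (k = 2)
-- would contradict each other.

PrimeKTuplesConjecture : Set
PrimeKTuplesConjecture =
  ∀ (k : ℕ) .{{_ : NonZero k}} (a : Fin k → ℕ) (b : Fin k → ℤ) →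
  (∀ i → 0 ℕ.< a i) →
  (∀ i → b i ≢ 0ℤ) →
  (∀ i j → a i ≡ a j → b i ≡ b j → i ≡ j) →
  (∀ p → Prime p → ¬ (∀ m → 1 ℕ.≤ m → + p ℤ.∣ productForm a b m)) →
  ∃ λ c → 0ℝ <ℝ c ×
    (λ x → fromℕ (primeTupleCount a b x)) ~
    (λ x → c *ℝ fromℕ x *ℝ reciprocal (log x ^ℝ k) (^ℝ-pos {log x} (log-pos x) k))

{-# OPTIONS --safe #-}

-- Take pᵢ = aᵢ m - 1 with (aᵢ) = 432 · (2, 3, 4, 9, 18), and n = p₁ p₂ p₃ p₄ p₅.  No prime q
-- divides all the values of ∏ (aᵢ m - 1), since every factor is -1 modulo q at m = q; so the
-- conjecture makes all five pᵢ prime for arbitrarily large m.  For m ≥ 19 the base pᵢ + 2 digits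
-- of n + 2 are explicit affine functions of m, with digit sum 1 + αᵢ (pᵢ + 1) for
-- (αᵢ) = (2, 3, 4, 2, 3).  This gives the degree 4, and also the divisibility pᵢ + 1 ∣ n + 1,
-- because a number is congruent to its digit sum modulo the base minus 1.

module Submission where

open import Defs
open import Data.Digit using (Expansion; fromDigits; toDigits)
open import Data.Fin.Base using (Fin; zero; suc; toℕ)
open import Data.Fin.Properties using (all?; toℕ<n)
import Data.Fin.Properties as Fin
open import Data.Integer.Base as ℤ using (ℤ; 1ℤ; -1ℤ)
import Data.Integer.Divisibility as ℤ
import Data.Integer.Properties as ℤₚ
open import Data.List.Base using (List; []; _∷_; applyUpTo; filter; foldr; length; map; upTo)
open import Data.List.Extrema.Nat using (max)
open import Data.List.Membership.Propositional using (_∈_)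
open import Data.List.Membership.Propositional.Properties using (∈-filter⁺; ∈-filter⁻; ∈-upTo⁺)
open import Data.List.Membership.Propositional.Properties.WithK using (unique∧set⇒bag)
open import Data.List.Properties using (map-upTo)
open import Data.List.Relation.Binary.BagAndSetEquality using (∼bag⇒↭)
open import Data.List.Relation.Binary.Permutation.Propositional using (↭⇒↭ₛ)
open import Data.List.Relation.Binary.Pointwise using (Pointwise; Pointwise-≡⇒≡; []; _∷_)
open import Data.List.Relation.Unary.All as All using (All; []; _∷_)
import Data.List.Relation.Unary.All.Properties as Allₚ
open import Data.List.Relation.Unary.AllPairs as AllPairs using (AllPairs; []; _∷_)
import Data.List.Relation.Unary.AllPairs.Properties as AllPairsₚ
open import Data.List.Relation.Unary.Any using (here; there)
open import Data.List.Relation.Unary.Linked.Properties using (AllPairs⇒Linked)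
open import Data.List.Relation.Unary.Sorted.TotalOrder.Properties using (↗↭↗⇒≋)
open import Data.Nat.Base
open import Data.Nat.Divisibility
open import Data.Nat.DivMod using ([m+kn]%n≡m%n; m<n⇒m%n≡m; m*n/n≡m)
open import Data.Nat.ListAction using (sum; product)
open import Data.Nat.ListAction.Properties using (∈⇒∣product; ∈⇒≤product)
open import Data.Nat.Primality
open import Data.Nat.Primality.Factorisation using (factorise; factorisationHasAllPrimeFactors)
open import Data.Nat.Properties
import Data.Nat.Solver as ℕ
open import Data.Nat.Tactic.RingSolver using (solve-∀)
open import Data.Product.Base using (∃; _×_; _,_; proj₁; proj₂)
open import Data.Rational.Base as ℚ using (0ℚ; 1ℚ; ½; nonNegative; positive; 1/_)
import Data.Rational.Properties as ℚₚ
open import Data.Rational.Solver using (module +-*-Solver)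
open import Data.Sum.Base using (inj₁; inj₂)
open import Data.Vec.Base using (Vec; []; _∷_; lookup; toList)
import Data.Vec.Functional as Vector
open import Function.Bundles using (mk⇔)
open import Relation.Binary.PropositionalEquality
open import Relation.Nullary using (¬_; contradiction; yes; no)
open import Relation.Nullary.Decidable using (True; from-yes; toWitness; _×-dec_; _→-dec_)
open import Relation.Unary using (Pred; Decidable)

-- Prime values of linear forms

fromℕℚ-+ : ∀ m n → fromℕℚ (m + n) ≡ fromℕℚ m ℚ.+ fromℕℚ n
fromℕℚ-+ zero    n = sym (ℚₚ.+-identityˡ (fromℕℚ n))
fromℕℚ-+ (suc m) n = begin
  fromℕℚ (suc (m + n))          ≡⟨ fromℕℚ-suc (m + n) ⟩
  fromℕℚ (m + n) ℚ.+ 1ℚ         ≡⟨ cong (ℚ._+ 1ℚ) (fromℕℚ-+ m n) ⟩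
  fromℕℚ m ℚ.+ fromℕℚ n ℚ.+ 1ℚ  ≡⟨ swap (fromℕℚ m) (fromℕℚ n) 1ℚ ⟩
  fromℕℚ m ℚ.+ 1ℚ ℚ.+ fromℕℚ n  ≡⟨ cong (ℚ._+ fromℕℚ n) (fromℕℚ-suc m) ⟨
  fromℕℚ (suc m) ℚ.+ fromℕℚ n   ∎
  where
  open ≡-Reasoning
  open +-*-Solver
  swap : ∀ p q r → p ℚ.+ q ℚ.+ r ≡ p ℚ.+ r ℚ.+ q
  swap = solve 3 (λ p q r → p :+ q :+ r := p :+ r :+ q) refl

fromℕℚ-* : ∀ m n → fromℕℚ (m * n) ≡ fromℕℚ m ℚ.* fromℕℚ n
fromℕℚ-* zero    n = sym (ℚₚ.*-zeroˡ (fromℕℚ n))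
fromℕℚ-* (suc m) n = begin
  fromℕℚ (n + m * n)                  ≡⟨ fromℕℚ-+ n (m * n) ⟩
  fromℕℚ n ℚ.+ fromℕℚ (m * n)         ≡⟨ cong (fromℕℚ n ℚ.+_) (fromℕℚ-* m n) ⟩
  fromℕℚ n ℚ.+ fromℕℚ m ℚ.* fromℕℚ n  ≡⟨ gather (fromℕℚ m) (fromℕℚ n) ⟩
  (fromℕℚ m ℚ.+ 1ℚ) ℚ.* fromℕℚ n      ≡⟨ cong (ℚ._* fromℕℚ n) (fromℕℚ-suc m) ⟨
  fromℕℚ (suc m) ℚ.* fromℕℚ n         ∎
  where
  open ≡-Reasoning
  open +-*-Solver
  gather : ∀ p q → q ℚ.+ p ℚ.* q ≡ (p ℚ.+ 1ℚ) ℚ.* q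
  gather = solve 2 (λ p q → q :+ p :* q := (p :+ con 1ℚ) :* q) refl

0≤fromℕℚ : ∀ n → 0ℚ ℚ.≤ fromℕℚ n
0≤fromℕℚ zero    = ℚₚ.≤-refl
0≤fromℕℚ (suc n) = ℚₚ.≤-trans (ℚₚ.+-mono-≤ (0≤fromℕℚ n) (ℚₚ.<⇒≤ (ℚₚ.positive⁻¹ 1ℚ)))
  (ℚₚ.≤-reflexive (sym (fromℕℚ-suc n)))

fromℕℚ-mono-≤ : ∀ {m n} → m ≤ n → fromℕℚ m ℚ.≤ fromℕℚ n
fromℕℚ-mono-≤ {m} {n} m≤n = begin
  fromℕℚ m                     ≡⟨ ℚₚ.+-identityʳ _ ⟨
  fromℕℚ m ℚ.+ 0ℚ              ≤⟨ ℚₚ.+-monoʳ-≤ (fromℕℚ m) (0≤fromℕℚ (n ∸ m)) ⟩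
  fromℕℚ m ℚ.+ fromℕℚ (n ∸ m)  ≡⟨ fromℕℚ-+ m (n ∸ m) ⟨
  fromℕℚ (m + (n ∸ m))         ≡⟨ cong fromℕℚ (m+[n∸m]≡n m≤n) ⟩
  fromℕℚ n                     ∎
  where open ℚₚ.≤-Reasoning

fromℕℚ-cancel-≤ : ∀ {m n} → fromℕℚ m ℚ.≤ fromℕℚ n → m ≤ n
fromℕℚ-cancel-≤ {m} {n} h = ≮⇒≥ λ n<m → ℚₚ.<-irrefl refl
  (ℚₚ.<-≤-trans (n<sn n) (ℚₚ.≤-trans (fromℕℚ-mono-≤ n<m) h))
  where
  n<sn : ∀ n → fromℕℚ n ℚ.< fromℕℚ (suc n)
  n<sn n = subst₂ ℚ._<_ (ℚₚ.+-identityʳ (fromℕℚ n)) (sym (fromℕℚ-suc n))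
    (ℚₚ.+-monoʳ-< (fromℕℚ n) (ℚₚ.positive⁻¹ 1ℚ))

0≤* : ∀ {p q} → 0ℚ ℚ.≤ p → 0ℚ ℚ.≤ q → 0ℚ ℚ.≤ p ℚ.* q
0≤* {p} {q} 0≤p 0≤q = ℚₚ.≤-trans (ℚₚ.≤-reflexive (sym (ℚₚ.*-zeroʳ p)))
  (ℚₚ.*-monoˡ-≤-nonNeg p {{nonNegative 0≤p}} 0≤q)

riemann-2^ : ∀ j n → riemann (2 ^ j) n ℚ.≤ fromℕℚ j
riemann-2^ zero    n = ℚₚ.≤-refl
riemann-2^ (suc j) n = begin
  segment (suc n) ((2 ^ suc j ∸ 1) * suc n)
    ≡⟨ cong (segment (suc n)) split ⟩
  segment (suc n) (l + suc m)
    ≡⟨ segment-+ (suc n) l (suc m) ⟩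
  segment (suc n) l ℚ.+ segment (suc n + l) (suc m)
    ≡⟨ cong (λ a → segment (suc n) l ℚ.+ segment a (suc m)) base ⟩
  segment (suc n) l ℚ.+ segment (1 * suc m) (suc m)
    ≤⟨ ℚₚ.+-mono-≤ (riemann-2^ j n) (block-≤ 0 m) ⟩
  fromℕℚ j ℚ.+ 1ℚ
    ≡⟨ fromℕℚ-suc j ⟨
  fromℕℚ (suc j) ∎
  where
  open ℚₚ.≤-Reasoning
  k = 2 ^ j ∸ 1
  l = k * suc n
  m = n + l
  2^j : 2 ^ j ≡ suc k
  2^j = sym (m+[n∸m]≡n (m^n>0 2 j))
  lem : ∀ k n → (k + (1 + k + 0)) * (1 + n) ≡ k * (1 + n) + (1 + (n + k * (1 + n)))
  lem = solve-∀
  split : (2 ^ suc j ∸ 1) * suc n ≡ l + suc m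
  split = trans (cong (λ z → (2 * z ∸ 1) * suc n) 2^j) (lem k n)
  base : suc n + l ≡ 1 * suc m
  base = sym (*-identityˡ (suc m))

0≤riemann : ∀ x n → 0ℚ ℚ.≤ riemann x n
0≤riemann x n = 0≤segment (suc n) ((x ∸ 1) * suc n)

^ℝ-bounds : ∀ x n b → 0ℚ ℚ.≤ approx x n → approx x n ℚ.≤ fromℕℚ b →
  ∀ k → 0ℚ ℚ.≤ approx (x ^ℝ k) n × approx (x ^ℝ k) n ℚ.≤ fromℕℚ (b ^ k)
^ℝ-bounds x n b 0≤x x≤b zero    = ℚₚ.<⇒≤ (ℚₚ.positive⁻¹ 1ℚ) , ℚₚ.≤-refl
^ℝ-bounds x n b 0≤x x≤b (suc k) =
  let 0≤xᵏ , xᵏ≤bᵏ = ^ℝ-bounds x n b 0≤x x≤b k in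
  0≤* 0≤x 0≤xᵏ ,
  ℚₚ.≤-trans (*-mono-≤-nonNeg 0≤x (0≤fromℕℚ (b ^ k)) x≤b xᵏ≤bᵏ)
             (ℚₚ.≤-reflexive (sym (fromℕℚ-* b (b ^ k))))

reciprocal-inverse : ∀ y (0<y : 0ℝ <ℝ y) → ∃ λ N → ∀ n → N ≤ n →
  0ℚ ℚ.≤ approx (reciprocal y 0<y) n × approx y n ℚ.* approx (reciprocal y 0<y) n ≡ 1ℚ
reciprocal-inverse y (δ , 0<δ , N , h) = N , λ n N≤n →
  let
    term = δ ℚ.⊔ approx y n
    instance
      term-pos : ℚ.Positive term
      term-pos = positive (ℚₚ.<-≤-trans 0<δ (ℚₚ.p≤p⊔q δ (approx y n)))
      term-nonZero : ℚ.NonZero term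
      term-nonZero = ℚₚ.pos⇒nonZero term
    term≡ : term ≡ approx y n
    term≡ = ℚₚ.p≤q⇒p⊔q≡q (ℚₚ.≤-trans (ℚₚ.≤-reflexive (sym (ℚₚ.+-identityˡ δ))) (h n N≤n))
  in ℚₚ.<⇒≤ (ℚₚ.positive⁻¹ (1/ term) {{ℚₚ.1/pos⇒pos term}}) ,
     trans (cong (ℚ._* 1/ term) (sym term≡)) (ℚₚ.*-inverseʳ term)

n<2^n : ∀ n → n < 2 ^ n
n<2^n zero    = s≤s z≤n
n<2^n (suc n) = +-mono-≤ (m^n>0 2 n) (≤-trans (n<2^n n) (m≤m+n _ 0))

-- With j = 2 ^ (2 * s) the claim C * j ^ k ≤ 2 ^ j follows from C + 2 * s * k ≤ 2 ^ (2 * s).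
exponential-dominates : ∀ k C X → ∃ λ j → X ≤ 2 ^ j × C * j ^ k ≤ 2 ^ j
exponential-dominates k C X = j , X≤ , (begin
  C * j ^ k                ≤⟨ *-monoˡ-≤ (j ^ k) (<⇒≤ (n<2^n C)) ⟩
  2 ^ C * j ^ k            ≡⟨ cong (2 ^ C *_) (^-*-assoc 2 (2 * s) k) ⟩
  2 ^ C * 2 ^ (2 * s * k)  ≡⟨ ^-distribˡ-+-* 2 C _ ⟨
  2 ^ (C + 2 * s * k)      ≤⟨ ^-monoʳ-≤ 2 exponent ⟩
  2 ^ j                    ∎)
  where
  open ≤-Reasoning
  s = C + 2 * k + X
  j = 2 ^ (2 * s)
  s*s≤j : suc s * suc s ≤ j
  s*s≤j = begin
    suc s * suc s  ≤⟨ *-mono-≤ (n<2^n s) (n<2^n s) ⟩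
    2 ^ s * 2 ^ s  ≡⟨ ^-distribˡ-+-* 2 s s ⟨
    2 ^ (s + s)    ≡⟨ cong (λ z → 2 ^ (s + z)) (+-identityʳ s) ⟨
    j              ∎
  X≤ : X ≤ 2 ^ j
  X≤ = begin
    X              ≤⟨ m≤n+m X _ ⟩
    s              ≤⟨ n≤1+n s ⟩
    suc s          ≤⟨ m≤m*n (suc s) (suc s) ⟩
    suc s * suc s  ≤⟨ s*s≤j ⟩
    j              ≤⟨ <⇒≤ (n<2^n j) ⟩
    2 ^ j          ∎
  expand : ∀ C k X → let s = C + 2 * k + X in
    (1 + s) * (1 + s) ≡ C + 2 * s * k + (s * (C + X) + s + 2 * k + X + 1)
  expand = solve-∀
  exponent : C + 2 * s * k ≤ j
  exponent = ≤-trans (m≤m+n _ _) (≤-trans (≤-reflexive (sym (expand C k X))) s*s≤j)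

length-filter-applyUpTo : ∀ {ℓ} {P : Pred ℕ ℓ} (P? : Decidable P) f x N →
  N < length (filter P? (applyUpTo f x)) → ∃ λ i → N ≤ i × P (f i)
length-filter-applyUpTo P? f (suc x) N h with P? (f 0)
length-filter-applyUpTo P? f (suc x) N h | no _ =
  let i , N≤i , Pfi = length-filter-applyUpTo P? (λ i → f (suc i)) x N h
  in suc i , m≤n⇒m≤1+n N≤i , Pfi
length-filter-applyUpTo P? f (suc x) zero    h | yes Pf0 = 0 , z≤n , Pf0
length-filter-applyUpTo P? f (suc x) (suc N) (s≤s h) | yes _ =
  let i , N≤i , Pfi = length-filter-applyUpTo P? (λ i → f (suc i)) x N h
  in suc i , s≤s N≤i , Pfi

primeTupleCount>⇒∃ : ∀ {k} (a : Fin k → ℕ) b x N → N < primeTupleCount a b x →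
  ∃ λ m → N < m × ∀ i → IsPrime (linear a b i m)
primeTupleCount>⇒∃ a b x N h =
  let i , N≤i , Pi = length-filter-applyUpTo primeTuple? suc x N
        (subst (λ ms → N < length (filter primeTuple? ms)) (map-upTo suc x) h)
  in suc i , s≤s N≤i , Pi
  where primeTuple? = λ m → all? (λ i → isPrime? (linear a b i m))

asymptotic-lower : ∀ (c : ℝ) → 0ℝ <ℝ c → ∀ k (f : (x : ℕ) → .{{NonTrivial x}} → ℕ) →
  (λ x → fromℕ (f x)) ~
  (λ x → c *ℝ fromℕ x *ℝ reciprocal (log x ^ℝ k) (^ℝ-pos {log x} (log-pos x) k)) →
  ∀ N → ∃ λ x → ∃ λ (x>1 : NonTrivial x) → N < f x {{x>1}}
asymptotic-lower c (δ , 0<δ , Nc , δ≤c) k f f~g N = x , x>1 , fromℕℚ-cancel-≤ {suc N} {f x} N<f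
  where
  M = proj₁ (archimedean δ 0<δ)
  1/M≤δ = proj₂ (archimedean δ 0<δ)
  C = suc M * (2 * suc N + 1)
  close = f~g ½ (ℚₚ.positive⁻¹ ½)
  dominated = exponential-dominates k C (proj₁ close + 2)
  j = proj₁ dominated
  x = 2 ^ j
  X+2≤x : proj₁ close + 2 ≤ x
  X+2≤x = proj₁ (proj₂ dominated)
  x>1 : NonTrivial x
  x>1 = n>1⇒nonTrivial (≤-trans (m≤n+m 2 (proj₁ close)) X+2≤x)
  instance
    x-nonTrivial : NonTrivial x
    x-nonTrivial = x>1
  0<log^k = ^ℝ-pos {log x} (log-pos x) k
  recip = reciprocal-inverse (log x ^ℝ k) 0<log^k
  near = proj₂ close x (≤-trans (m≤m+n (proj₁ close) 2) X+2≤x) ½ (ℚₚ.positive⁻¹ ½)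
  n = Nc + proj₁ recip + proj₁ near
  r = approx (reciprocal (log x ^ℝ k) 0<log^k) n
  y = approx (log x ^ℝ k) n
  cₙ = approx c n
  F = fromℕℚ (f x)
  G = cₙ ℚ.* fromℕℚ x ℚ.* r
  0≤r : 0ℚ ℚ.≤ r
  0≤r = proj₁ (proj₂ recip n (≤-trans (m≤n+m _ Nc) (m≤m+n _ _)))
  y*r≡1 : y ℚ.* r ≡ 1ℚ
  y*r≡1 = proj₂ (proj₂ recip n (≤-trans (m≤n+m _ Nc) (m≤m+n _ _)))
  y≤ : y ℚ.≤ fromℕℚ (j ^ k)
  y≤ = proj₂ (^ℝ-bounds (log x) n j (0≤riemann x n) (riemann-2^ j n) k)
  1/M≤cₙ : 1/suc M ℚ.≤ cₙ
  1/M≤cₙ = ℚₚ.≤-trans 1/M≤δ (ℚₚ.≤-trans (ℚₚ.≤-reflexive (sym (ℚₚ.+-identityˡ δ)))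
    (δ≤c n (≤-trans (m≤m+n Nc _) (m≤m+n _ _))))
  0≤1/M : 0ℚ ℚ.≤ 1/suc M
  0≤1/M = ℚₚ.<⇒≤ (0<1/suc M)
  T = fromℕℚ (2 * suc N + 1)
  1/M*C : 1/suc M ℚ.* fromℕℚ C ≡ T
  1/M*C = begin
    1/suc M ℚ.* fromℕℚ C                    ≡⟨ cong (1/suc M ℚ.*_) (fromℕℚ-* (suc M) (2 * suc N + 1)) ⟩
    1/suc M ℚ.* (fromℕℚ (suc M) ℚ.* T)      ≡⟨ lem (1/suc M) (fromℕℚ (suc M)) T ⟩
    fromℕℚ (suc M) ℚ.* 1/suc M ℚ.* T        ≡⟨ cong (λ z → fromℕℚ (suc M) ℚ.* 1/suc z ℚ.* T) (+-identityʳ M) ⟨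
    fromℕℚ (suc M) ℚ.* 1/suc (M + 0) ℚ.* T  ≡⟨ cong (ℚ._* T) (fromℕℚ-1/suc 0 M) ⟩
    1ℚ ℚ.* T                                ≡⟨ ℚₚ.*-identityˡ T ⟩
    T                                       ∎
    where
    open ≡-Reasoning
    open +-*-Solver
    lem : ∀ p q r → p ℚ.* (q ℚ.* r) ≡ q ℚ.* p ℚ.* r
    lem = solve 3 (λ p q r → p :* (q :* r) := q :* p :* r) refl
  open ℚₚ.≤-Reasoning
  T≤G : T ℚ.≤ G
  T≤G = begin
    T
      ≡⟨ 1/M*C ⟨
    1/suc M ℚ.* fromℕℚ C
      ≡⟨ ℚₚ.*-identityʳ _ ⟨
    1/suc M ℚ.* fromℕℚ C ℚ.* 1ℚ
      ≡⟨ cong (1/suc M ℚ.* fromℕℚ C ℚ.*_) y*r≡1 ⟨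
    1/suc M ℚ.* fromℕℚ C ℚ.* (y ℚ.* r)
      ≤⟨ ℚₚ.*-monoˡ-≤-nonNeg (1/suc M ℚ.* fromℕℚ C) {{nonNegative (0≤* 0≤1/M (0≤fromℕℚ C))}}
           (ℚₚ.*-monoʳ-≤-nonNeg r {{nonNegative 0≤r}} y≤) ⟩
    1/suc M ℚ.* fromℕℚ C ℚ.* (fromℕℚ (j ^ k) ℚ.* r)
      ≡⟨ lem (1/suc M) (fromℕℚ C) (fromℕℚ (j ^ k)) r ⟩
    1/suc M ℚ.* (fromℕℚ C ℚ.* fromℕℚ (j ^ k)) ℚ.* r
      ≡⟨ cong (λ z → 1/suc M ℚ.* z ℚ.* r) (fromℕℚ-* C (j ^ k)) ⟨
    1/suc M ℚ.* fromℕℚ (C * j ^ k) ℚ.* r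
      ≤⟨ ℚₚ.*-monoʳ-≤-nonNeg r {{nonNegative 0≤r}}
           (*-mono-≤-nonNeg 0≤1/M (0≤fromℕℚ x) 1/M≤cₙ (fromℕℚ-mono-≤ (proj₂ (proj₂ dominated)))) ⟩
    G ∎
    where
    open +-*-Solver
    lem : ∀ p q r s → p ℚ.* q ℚ.* (r ℚ.* s) ≡ p ℚ.* (q ℚ.* r) ℚ.* s
    lem = solve 4 (λ p q r s → p :* q :* (r :* s) := p :* (q :* r) :* s) refl
  ∣F-G∣≤ : ℚ.∣ F ℚ.- G ∣ ℚ.≤ ½ ℚ.* ℚ.∣ G ∣ ℚ.+ ½
  ∣F-G∣≤ = proj₂ near n (m≤n+m _ _)
  ∣G∣≡G : ℚ.∣ G ∣ ≡ G
  ∣G∣≡G = ℚₚ.0≤p⇒∣p∣≡p (ℚₚ.≤-trans (0≤fromℕℚ (2 * suc N + 1)) T≤G)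
  G≤ : G ℚ.≤ F ℚ.+ (½ ℚ.* G ℚ.+ ½)
  G≤ = ∣-∣-elim (subst₂ ℚ._≤_ (∣-∣-sym F G) (cong (λ z → ½ ℚ.* z ℚ.+ ½) ∣G∣≡G) ∣F-G∣≤)
  N<f : fromℕℚ (suc N) ℚ.≤ F
  N<f = begin
    fromℕℚ (suc N)
      ≡⟨ halve (fromℕℚ (suc N)) ⟩
    ½ ℚ.* ((1ℚ ℚ.+ 1ℚ) ℚ.* fromℕℚ (suc N) ℚ.+ 1ℚ) ℚ.- ½
      ≡⟨ cong (λ z → ½ ℚ.* z ℚ.- ½) T≡ ⟨
    ½ ℚ.* T ℚ.- ½
      ≤⟨ ℚₚ.+-monoˡ-≤ (ℚ.- ½) (ℚₚ.*-monoˡ-≤-nonNeg ½ T≤G) ⟩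
    ½ ℚ.* G ℚ.- ½
      ≡⟨ expand G ⟩
    G ℚ.- (½ ℚ.* G ℚ.+ ½)
      ≤⟨ ℚₚ.+-monoˡ-≤ (ℚ.- (½ ℚ.* G ℚ.+ ½)) G≤ ⟩
    F ℚ.+ (½ ℚ.* G ℚ.+ ½) ℚ.- (½ ℚ.* G ℚ.+ ½)
      ≡⟨ cancel F (½ ℚ.* G ℚ.+ ½) ⟩
    F ∎
    where
    open +-*-Solver
    T≡ : T ≡ (1ℚ ℚ.+ 1ℚ) ℚ.* fromℕℚ (suc N) ℚ.+ 1ℚ
    T≡ = trans (fromℕℚ-+ (2 * suc N) 1) (cong (ℚ._+ 1ℚ) (fromℕℚ-* 2 (suc N)))
    halve : ∀ p → p ≡ ½ ℚ.* ((1ℚ ℚ.+ 1ℚ) ℚ.* p ℚ.+ 1ℚ) ℚ.- ½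
    halve = solve 1 (λ p → p := con ½ :* ((con 1ℚ :+ con 1ℚ) :* p :+ con 1ℚ) :- con ½) refl
    expand : ∀ p → ½ ℚ.* p ℚ.- ½ ≡ p ℚ.- (½ ℚ.* p ℚ.+ ½)
    expand = solve 1 (λ p → con ½ :* p :- con ½ := p :- (con ½ :* p :+ con ½)) refl
    cancel : ∀ p q → p ℚ.+ q ℚ.- q ≡ p
    cancel = solve 2 (λ p q → p :+ q :- q := p) refl

prime∣foldr-* : ∀ {p} → Prime p → ∀ {k} (z : Fin k → ℤ) →
  ℤ.+ p ℤ.∣ Vector.foldr ℤ._*_ 1ℤ z → ∃ λ i → ℤ.+ p ℤ.∣ z i
prime∣foldr-* p-prime {zero}  z p∣1 = contradiction (subst Prime (∣1⇒≡1 p∣1) p-prime) ¬prime[1]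
prime∣foldr-* {p} p-prime {suc k} z p∣zs
  with euclidsLemma ℤ.∣ z zero ∣ _ p-prime (subst (p ∣_) (ℤₚ.abs-* (z zero) _) p∣zs)
... | inj₁ p∣z  = zero , p∣z
... | inj₂ p∣zs =
  let i , p∣zᵢ = prime∣foldr-* p-prime (λ i → z (suc i)) p∣zs in suc i , p∣zᵢ

linear-pred : ∀ {k} (a : Fin k → ℕ) i m {p} → suc p ≡ a i * m → linear a (λ _ → -1ℤ) i m ≡ ℤ.+ p
linear-pred a i m eq = cong (ℤ._+ -1ℤ) (trans (sym (ℤₚ.pos-* (a i) m)) (cong ℤ.+_ (sym eq)))

noFixedDivisor : ∀ {k} (a : Fin k → ℕ) → (∀ i → 0 < a i) →
  ∀ p → Prime p → ¬ (∀ m → 1 ≤ m → ℤ.+ p ℤ.∣ productForm a (λ _ → -1ℤ) m)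
noFixedDivisor a 0<a p p-prime p∣f = ¬prime[1] (subst Prime (∣1⇒≡1 p∣1) p-prime)
  where
  0<p : 0 < p
  0<p = >-nonZero⁻¹ p {{prime⇒nonZero p-prime}}
  factor = prime∣foldr-* p-prime (λ i → linear a (λ _ → -1ℤ) i p) (p∣f p 0<p)
  i = proj₁ factor
  q = a i * p ∸ 1
  q+1 : suc q ≡ a i * p
  q+1 = m+[n∸m]≡n (*-mono-≤ (0<a i) 0<p)
  p∣q : p ∣ q
  p∣q = subst (ℤ.+ p ℤ.∣_) (linear-pred a i p q+1) (proj₂ factor)
  p∣1 : p ∣ 1
  p∣1 = ∣m+n∣m⇒∣n (subst (p ∣_) (trans (sym q+1) (+-comm 1 q)) (n∣m*n (a i))) p∣q

infinitelyManyPrimeTuples : PrimeKTuplesConjecture → ∀ k .{{_ : NonZero k}} (a : Fin k → ℕ) →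
  (∀ i → 0 < a i) → (∀ i j → a i ≡ a j → i ≡ j) →
  ∀ N → ∃ λ m → N < m × ∀ i → IsPrime (linear a (λ _ → -1ℤ) i m)
infinitelyManyPrimeTuples conj k a 0<a a-injective N =
  let c , 0<c , count~ = conj k a (λ _ → -1ℤ) 0<a (λ _ ()) (λ i j aᵢ≡aⱼ _ → a-injective i j aᵢ≡aⱼ)
                           (noFixedDivisor a 0<a)
      x , x>1 , N<count = asymptotic-lower c 0<c k (λ x → primeTupleCount a (λ _ → -1ℤ) x) count~ N
  in primeTupleCount>⇒∃ a (λ _ → -1ℤ) x N N<count

-- Digit expansions

horner : ℕ → List ℕ → ℕ
horner b []       = 0
horner b (d ∷ ds) = d + horner b ds * b

divMod-unique : ∀ {b r s} q q′ → r < b → s < b → r + q * b ≡ s + q′ * b → r ≡ s × q ≡ q′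
divMod-unique {b@(suc _)} {r} {s} q q′ r<b s<b eq = r≡s , *-cancelʳ-≡ q q′ b
  (+-cancelˡ-≡ r (q * b) (q′ * b) (trans eq (cong (_+ q′ * b) (sym r≡s))))
  where
  open ≡-Reasoning
  r≡s : r ≡ s
  r≡s = begin
    r                 ≡⟨ m<n⇒m%n≡m r<b ⟨
    r % b             ≡⟨ [m+kn]%n≡m%n r q b ⟨
    (r + q * b) % b   ≡⟨ cong (_% b) eq ⟩
    (s + q′ * b) % b  ≡⟨ [m+kn]%n≡m%n s q′ b ⟩
    s % b             ≡⟨ m<n⇒m%n≡m s<b ⟩
    s                 ∎

-- Leading zeros may differ, so the expansions themselves need not agree.
fromDigits≡horner⇒sum≡ : ∀ {b} → 0 < b → (ds : Expansion b) (es : List ℕ) → All (_< b) es →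
  fromDigits ds ≡ horner b es → sum (map toℕ ds) ≡ sum es
fromDigits≡horner⇒sum≡ 0<b []       []       _            eq = refl
fromDigits≡horner⇒sum≡ 0<b []       (e ∷ es) (e<b ∷ es<b) eq =
  let 0≡e , 0≡es = divMod-unique 0 (horner _ es) 0<b e<b eq
  in cong₂ _+_ 0≡e (fromDigits≡horner⇒sum≡ 0<b [] es es<b 0≡es)
fromDigits≡horner⇒sum≡ 0<b (d ∷ ds) []       []           eq =
  let d≡0 , ds≡0 = divMod-unique (fromDigits ds) 0 (toℕ<n d) 0<b eq
  in cong₂ _+_ d≡0 (fromDigits≡horner⇒sum≡ 0<b ds [] [] ds≡0)
fromDigits≡horner⇒sum≡ 0<b (d ∷ ds) (e ∷ es) (e<b ∷ es<b) eq =
  let d≡e , ds≡es = divMod-unique (fromDigits ds) (horner _ es) (toℕ<n d) e<b eq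
  in cong₂ _+_ d≡e (fromDigits≡horner⇒sum≡ 0<b ds es es<b ds≡es)

digitSum-unique : ∀ b {b≥2 : True (2 ≤? b)} {n} es → All (_< b) es → n ≡ horner b es →
  digitSum b {b≥2} n ≡ sum es
digitSum-unique b@(suc (suc _)) {b≥2} {n} es es<b n≡ =
  fromDigits≡horner⇒sum≡ (s≤s z≤n) (proj₁ (toDigits b {b≥2} n)) es es<b
    (trans (proj₂ (toDigits b {b≥2} n)) n≡)

horner≡sum+ : ∀ c ds → ∃ λ k → horner (suc c) ds ≡ sum ds + k * c
horner≡sum+ c []       = 0 , refl
horner≡sum+ c (d ∷ ds) = let k , eq = horner≡sum+ c ds in
  k + horner (suc c) ds , trans (cong (λ h → d + h * suc c) eq)
    (trans (lem d (sum ds) k c) (cong (λ h → d + sum ds + (k + h) * c) (sym eq)))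
  where
  lem : ∀ d s k c → d + (s + k * c) * (1 + c) ≡ d + s + (k + (s + k * c)) * c
  lem = solve-∀

record DegreeAt (n p α : ℕ) : Set where
  field
    quotient≡   : (digitSum (2 + p) (2 + n) ∸ 1) / suc p ≡ α
    1+p∣1+n     : suc p ∣ suc n

open DegreeAt

degreeAt : ∀ n p α es → All (_< 2 + p) es → 2 + n ≡ horner (2 + p) es → sum es ≡ suc (α * suc p) →
  DegreeAt n p α
degreeAt n p α es es<2+p expansion sum-es = record
  { quotient≡ = trans
      (cong (λ s → (s ∸ 1) / suc p) (trans (digitSum-unique (2 + p) es es<2+p expansion) sum-es))
      (m*n/n≡m α (suc p))
  ; 1+p∣1+n = let k , eq = horner≡sum+ (suc p) es in
      divides (α + k) (suc-injective (trans expansion (trans eq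
        (trans (cong (_+ k * suc p) sum-es) (cong suc (sym (*-distribʳ-+ (suc p) α k)))))))
  }

-- Products of distinct primes

Ascending : List ℕ → Set
Ascending = AllPairs _<_

ascending-unique : ∀ {xs ys} → Ascending xs → Ascending ys →
  (∀ {x} → x ∈ xs → x ∈ ys) → (∀ {x} → x ∈ ys → x ∈ xs) → xs ≡ ys
ascending-unique xs↗ ys↗ xs⊆ys ys⊆xs = Pointwise-≡⇒≡
  (↗↭↗⇒≋ ≤-totalOrder (sorted xs↗) (sorted ys↗)
    (↭⇒↭ₛ (∼bag⇒↭ (unique∧set⇒bag (AllPairs.map <⇒≢ xs↗) (AllPairs.map <⇒≢ ys↗)
      (mk⇔ xs⊆ys ys⊆xs)))))
  where
  sorted = λ {xs} (xs↗ : Ascending xs) → AllPairs⇒Linked (AllPairs.map <⇒≤ xs↗)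

primeDivisors-product : ∀ {ps} → All Prime ps → Ascending ps → primeDivisors (product ps) ≡ ps
primeDivisors-product {ps} primes ps↗ = ascending-unique
  (AllPairsₚ.filter⁺ primeDivisor? (AllPairsₚ.applyUpTo⁺₁ _ (suc (product ps)) (λ i<j _ → i<j))) ps↗
  (λ p∈ → let _ , p-prime , p∣ = ∈-filter⁻ primeDivisor? {xs = upTo (suc (product ps))} p∈ in
    factorisationHasAllPrimeFactors p-prime p∣ primes)
  (λ p∈ → ∈-filter⁺ primeDivisor?
    (∈-upTo⁺ (s≤s (∈⇒≤product (All.map prime⇒nonZero primes) p∈)))
    (All.lookup primes p∈ , ∈⇒∣product p∈))
  where primeDivisor? = λ p → prime? p ×-dec (p ∣? product ps)

¬prime²∣product : ∀ {q ps} → Prime q → All Prime ps → Ascending ps → ¬ (q * q ∣ product ps)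
¬prime²∣product {q} {[]} q-prime [] [] q²∣ =
  ¬prime[1] (subst Prime (∣1⇒≡1 (∣-trans (m∣m*n q) q²∣)) q-prime)
¬prime²∣product {q} {p ∷ ps} q-prime (p-prime ∷ primes) (p<ps ∷ ps↗) q²∣
  with factorisationHasAllPrimeFactors q-prime (∣-trans (m∣m*n q) q²∣) (p-prime ∷ primes)
... | here refl = <-irrefl refl (All.lookup p<ps
  (factorisationHasAllPrimeFactors q-prime (*-cancelˡ-∣ q {{prime⇒nonZero q-prime}} q²∣) primes))
... | there q∈ps = ¬prime²∣product q-prime primes ps↗ q²∣Πps
  where
  instance
    q-nonZero : NonZero q
    q-nonZero = prime⇒nonZero q-prime
  r = quotient (∈⇒∣product q∈ps)
  Πps≡q*r : product ps ≡ q * r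
  Πps≡q*r = trans (_∣_.equality (∈⇒∣product q∈ps)) (*-comm r q)
  swap : ∀ p q r → p * (q * r) ≡ q * (p * r)
  swap = solve-∀
  q²∣Πps : q * q ∣ product ps
  q²∣Πps with euclidsLemma p r q-prime (*-cancelˡ-∣ q
    (subst (q * q ∣_) (trans (cong (p *_) Πps≡q*r) (swap p q r)) q²∣))
  ... | inj₂ q∣r = subst (q * q ∣_) (sym Πps≡q*r) (*-monoʳ-∣ q q∣r)
  ... | inj₁ q∣p with prime⇒irreducible p-prime q∣p
  ...   | inj₁ q≡1 = contradiction (subst Prime q≡1 q-prime) ¬prime[1]
  ...   | inj₂ q≡p = contradiction (All.lookup p<ps q∈ps) (<-irrefl (sym q≡p))

squareFree-product : ∀ {ps} → All Prime ps → Ascending ps → SquareFree (product ps)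
squareFree-product {ps} primes ps↗ zero 0∣Πps =
  contradiction (0∣⇒≡0 0∣Πps) (≢-nonZero⁻¹ (product ps) {{productOfPrimes≢0 primes}})
squareFree-product {ps} primes ps↗ d@(suc _) d²∣Πps with factorise d
... | record { factors = [] ; isFactorisation = d≡1 } = d≡1
... | record { factors = q ∷ qs ; isFactorisation = d≡ ; factorsPrime = q-prime ∷ _ } =
  contradiction (∣-trans (*-pres-∣ q∣d q∣d) d²∣Πps) (¬prime²∣product q-prime primes ps↗)
  where
  q∣d : q ∣ d
  q∣d = subst (q ∣_) (sym d≡) (m∣m*n (product qs))

composite-product : ∀ {ps} → All Prime ps → 2 ≤ length ps → Composite (product ps)
composite-product {_ ∷ []} _ (s≤s ())
composite-product {p ∷ q ∷ ps} (p-prime ∷ q-prime ∷ primes) _ =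
  composite {d = p} (m<m*n p (q * product ps) (<-≤-trans (nonTrivial⇒n>1 q)
    (m≤m*n q (product ps) {{productOfPrimes≢0 primes}}))) (m∣m*n _)
  where
  instance
    p-nonTrivial : NonTrivial p
    p-nonTrivial = prime⇒nonTrivial p-prime
    q-nonTrivial : NonTrivial q
    q-nonTrivial = prime⇒nonTrivial q-prime
    p-nonZero : NonZero p
    p-nonZero = prime⇒nonZero p-prime

lucasCarmichael-product : ∀ ps {αs} → 2 ≤ length ps → All Prime ps → Ascending ps →
  Pointwise (DegreeAt (product ps)) ps αs → LucasCarmichael (product ps)
lucasCarmichael-product ps 2≤|ps| primes ps↗ degrees = record
  { composite  = composite-product primes 2≤|ps|
  ; squareFree = squareFree-product primes ps↗
  ; 1+p∣1+n    = λ q q-prime q∣n →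
      All.lookup (1+q∣1+n degrees) (factorisationHasAllPrimeFactors q-prime q∣n primes)
  }
  where
  1+q∣1+n : ∀ {qs βs} → Pointwise (DegreeAt (product ps)) qs βs → All (λ q → suc q ∣ suc (product ps)) qs
  1+q∣1+n []       = []
  1+q∣1+n (d ∷ ds) = 1+p∣1+n d ∷ 1+q∣1+n ds

degree≡max : ∀ n {ps αs} → primeDivisors n ≡ ps → Pointwise (DegreeAt n) ps αs → degree n ≡ max 0 αs
degree≡max n primeDivisors≡ degrees =
  cong (max 0) (trans (cong (map quotientAt) primeDivisors≡) (quotients degrees))
  where
  quotientAt : ℕ → ℕ
  quotientAt p = (digitSum (2 + p) (2 + n) ∸ 1) / suc p
  quotients : ∀ {qs βs} → Pointwise (DegreeAt n) qs βs → map quotientAt qs ≡ βs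
  quotients []       = refl
  quotients (d ∷ ds) = cong₂ _∷_ (quotient≡ d) (quotients ds)

affine : ℕ × ℕ → ℕ → ℕ
affine (u , v) t = u * t + v

sum-affine : ∀ ds t → sum (map (λ d → affine d t) ds) ≡ affine (sum (map proj₁ ds) , sum (map proj₂ ds)) t
sum-affine []             t = refl
sum-affine ((u , v) ∷ ds) t = trans (cong (affine (u , v) t +_) (sum-affine ds t))
  (lem u v (sum (map proj₁ ds)) (sum (map proj₂ ds)) t)
  where
  lem : ∀ u v x y t → u * t + v + (x * t + y) ≡ (u + x) * t + (v + y)
  lem = solve-∀

degreeAt-affine : ∀ n f α t ds →
  {small : True (All.all? (λ d → (proj₁ d ≤? proj₁ f) ×-dec (proj₂ d <? 2 + proj₂ f)) ds)} →
  sum (map proj₁ ds) ≡ α * proj₁ f → sum (map proj₂ ds) ≡ suc (α * suc (proj₂ f)) →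
  2 + n ≡ horner (2 + affine f t) (map (λ d → affine d t) ds) →
  DegreeAt n (affine f t) α
degreeAt-affine n f@(u , v) α t ds {small} Σu Σv expansion =
  degreeAt n p α es es<2+p expansion sum-es
  where
  p = affine f t
  es = map (λ d → affine d t) ds
  es<2+p : All (_< 2 + p) es
  es<2+p = Allₚ.map⁺ (All.map (λ (x≤u , y<2+v) → <-≤-trans
    (+-mono-≤-< (*-monoˡ-≤ t x≤u) y<2+v) (≤-reflexive (lem (u * t) v))) (toWitness small))
    where
    lem : ∀ x y → x + (2 + y) ≡ 2 + (x + y)
    lem = solve-∀
  sum-es : sum es ≡ suc (α * suc p)
  sum-es = trans (sum-affine ds t) (trans (cong₂ (λ x y → x * t + y) Σu Σv) (lem α u v t))
    where
    lem : ∀ α u v t → α * u * t + (1 + α * (1 + v)) ≡ 1 + α * (1 + (u * t + v))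
    lem = solve-∀

-- The five primes

coefficients : Vec ℕ 5
coefficients = 864 ∷ 1296 ∷ 1728 ∷ 3888 ∷ 7776 ∷ []

-- The form a * m - 1 at m = 19 + t, as a polynomial in t.
form : ℕ → ℕ × ℕ
form a = a , 19 * a ∸ 1

forms : List (ℕ × ℕ)
forms = map form (toList coefficients)

primesAt : ℕ → List ℕ
primesAt t = map (λ f → affine f t) forms

suc-affine-form : ∀ a .{{_ : NonZero a}} t → suc (affine (form a) t) ≡ a * (19 + t)
suc-affine-form a@(suc _) t = trans (sym (+-suc (a * t) (19 * a ∸ 1)))
  (trans (cong (a * t +_) (suc-pred (19 * a))) (lem a t))
  where
  lem : ∀ a t → a * t + 19 * a ≡ a * (19 + t)
  lem = solve-∀

primesAt-ascending : ∀ t → Ascending (primesAt t)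
primesAt-ascending t = AllPairsₚ.map⁺ (AllPairs.map
  (λ (a≤b , c<d) → +-mono-≤-< (*-monoˡ-≤ t a≤b) c<d)
  (from-yes (AllPairs.allPairs? (λ f g → (proj₁ f ≤? proj₁ g) ×-dec (proj₂ f <? proj₂ g)) forms)))

module _ where
  open ℕ.+-*-Solver

  -- Solver syntax whose semantics unfolds to affine, product and horner.

  affine-poly : ∀ {k} → ℕ × ℕ → Polynomial k → Polynomial k
  affine-poly (u , v) t = con u :* t :+ con v

  product-poly : ∀ {k} → List (Polynomial k) → Polynomial k
  product-poly = foldr _:*_ (con 1)

  horner-poly : ∀ {k} → Polynomial k → List (Polynomial k) → Polynomial k
  horner-poly b []       = con 0
  horner-poly b (d ∷ ds) = d :+ horner-poly b ds :* b

  expansion-poly : ∀ {k} → ℕ × ℕ → List (ℕ × ℕ) → Polynomial k → Polynomial k × Polynomial k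
  expansion-poly f ds t =
    con 2 :+ product-poly (map (λ f → affine-poly f t) forms) :=
    horner-poly (con 2 :+ affine-poly f t) (map (λ d → affine-poly d t) ds)

-- digitsᵢ lists the digits of n + 2 in base pᵢ + 2 at m = 19 + t, as polynomials in t.

digits₁ : List (ℕ × ℕ)
digits₁ = (864 , 15594) ∷ (0 , 2874) ∷ (216 , 140) ∷ (216 , 6807) ∷ (432 , 7297) ∷ (0 , 121) ∷ []

expansion₁ : ∀ t → 2 + product (primesAt t) ≡
  horner (2 + affine (form 864) t) (map (λ d → affine d t) digits₁)
expansion₁ = ℕ.+-*-Solver.solve 1 (expansion-poly (form 864) digits₁) refl

digits₂ : List (ℕ × ℕ)
digits₂ = (1008 , 18937) ∷ (432 , 8878) ∷ (1152 , 21078) ∷ (0 , 480) ∷ (1296 , 24485) ∷ (0 , 15) ∷ []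

expansion₂ : ∀ t → 2 + product (primesAt t) ≡
  horner (2 + affine (form 1296) t) (map (λ d → affine d t) digits₂)
expansion₂ = ℕ.+-*-Solver.solve 1 (expansion-poly (form 1296) digits₂) refl

digits₃ : List (ℕ × ℕ)
digits₃ = (1458 , 27611) ∷ (1161 , 22319) ∷ (1485 , 27934) ∷ (1431 , 27337) ∷ (1377 , 26125) ∷ (0 , 3) ∷ []

expansion₃ : ∀ t → 2 + product (primesAt t) ≡
  horner (2 + affine (form 1728) t) (map (λ d → affine d t) digits₃)
expansion₃ = ℕ.+-*-Solver.solve 1 (expansion-poly (form 1728) digits₃) refl

digits₄ : List (ℕ × ℕ)
digits₄ = (480 , 9108) ∷ (784 , 14923) ∷ (2384 , 45277) ∷ (3872 , 73575) ∷ (256 , 4862) ∷ []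

expansion₄ : ∀ t → 2 + product (primesAt t) ≡
  horner (2 + affine (form 3888) t) (map (λ d → affine d t) digits₄)
expansion₄ = ℕ.+-*-Solver.solve 1 (expansion-poly (form 3888) digits₄) refl

digits₅ : List (ℕ × ℕ)
digits₅ = (5856 , 111262) ∷ (6016 , 114310) ∷ (4088 , 77669) ∷ (7352 , 139689) ∷ (16 , 303) ∷ []

expansion₅ : ∀ t → 2 + product (primesAt t) ≡
  horner (2 + affine (form 7776) t) (map (λ d → affine d t) digits₅)
expansion₅ = ℕ.+-*-Solver.solve 1 (expansion-poly (form 7776) digits₅) refl

module _ (t : ℕ) where

  private
    n = product (primesAt t)

  degreeAt₁ : DegreeAt n (affine (form 864) t) 2
  degreeAt₁ = degreeAt-affine n (form 864) 2 t digits₁ refl refl (expansion₁ t)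

  degreeAt₂ : DegreeAt n (affine (form 1296) t) 3
  degreeAt₂ = degreeAt-affine n (form 1296) 3 t digits₂ refl refl (expansion₂ t)

  degreeAt₃ : DegreeAt n (affine (form 1728) t) 4
  degreeAt₃ = degreeAt-affine n (form 1728) 4 t digits₃ refl refl (expansion₃ t)

  degreeAt₄ : DegreeAt n (affine (form 3888) t) 2
  degreeAt₄ = degreeAt-affine n (form 3888) 2 t digits₄ refl refl (expansion₄ t)

  degreeAt₅ : DegreeAt n (affine (form 7776) t) 3
  degreeAt₅ = degreeAt-affine n (form 7776) 3 t digits₅ refl refl (expansion₅ t)

  degreesAt : Pointwise (DegreeAt n) (primesAt t) (2 ∷ 3 ∷ 4 ∷ 2 ∷ 3 ∷ [])
  degreesAt = degreeAt₁ ∷ degreeAt₂ ∷ degreeAt₃ ∷ degreeAt₄ ∷ degreeAt₅ ∷ []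

primesAt-large : ∀ t → All Prime (primesAt t) → 19 + t ≤ product (primesAt t)
primesAt-large t primes = ≤-trans (≤-trans
  (+-mono-≤ (from-yes (19 ≤? proj₂ (form 864))) (m≤n*m t 864))
  (≤-reflexive (+-comm (proj₂ (form 864)) (864 * t))))
  (∈⇒≤product (All.map prime⇒nonZero primes) (here refl))

primesAt-prime : ∀ t → (∀ i → IsPrime (linear (lookup coefficients) (λ _ → -1ℤ) i (19 + t))) →
  All Prime (primesAt t)
primesAt-prime t h =
  at zero ∷ at (suc zero) ∷ at (suc (suc zero)) ∷ at (suc (suc (suc zero))) ∷
  at (suc (suc (suc (suc zero)))) ∷ []
  where
  coefficient>0 : ∀ i → 0 < lookup coefficients i
  coefficient>0 = from-yes (all? λ i → 0 <? lookup coefficients i)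
  at : ∀ i → Prime (affine (form (lookup coefficients i)) t)
  at i = subst IsPrime (linear-pred (lookup coefficients) i (19 + t)
    (suc-affine-form (lookup coefficients i) {{>-nonZero (coefficient>0 i)}} t)) (h i)

theorem4p4 : PrimeKTuplesConjecture → ∀ (N : ℕ) → ∃ λ (n : ℕ) → N < n × LucasCarmichael n × degree n ≡ 4 × length (primeDivisors n) ≡ 5
theorem4p4 conj N =
  let m , N+18<m , m-prime = infinitelyManyPrimeTuples conj 5 (lookup coefficients)
        (from-yes (all? λ i → 0 <? lookup coefficients i))
        (from-yes (all? λ i → all? λ j → (lookup coefficients i ≟ lookup coefficients j) →-dec (i Fin.≟ j)))
        (N + 18)
      t = m ∸ 19
      19+t≡m = m+[n∸m]≡n (≤-trans (s≤s (m≤n+m 18 N)) N+18<m)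
      primes = primesAt-prime t λ i →
        subst (λ m → IsPrime (linear (lookup coefficients) (λ _ → -1ℤ) i m)) (sym 19+t≡m) (m-prime i)
      primeDivisors≡ = primeDivisors-product primes (primesAt-ascending t)
  in product (primesAt t) ,
     ≤-trans (≤-trans (s≤s (m≤m+n N 18)) N+18<m)
       (≤-trans (≤-reflexive (sym 19+t≡m)) (primesAt-large t primes)) ,
     lucasCarmichael-product (primesAt t) (s≤s (s≤s z≤n)) primes (primesAt-ascending t) (degreesAt t) ,
     degree≡max (product (primesAt t)) primeDivisors≡ (degreesAt t) ,
     cong length primeDivisors≡
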